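{- If $T$ is a subcubic tree of order $n$, then $\psi(T)\le \frac{4n+2}{5}$. Furthermore, equality holds if and only if $T$ arises from $K_2$ by iteratively attaching $P_5$'s (i.e., by applying the operation of attaching a $P_5$ zero or more times).
   Context: All graphs are finite, simple and undirected. A subcubic tree is a tree of maximum degree at most $3$. A dissociation set in a graph $G$ is a vertex subset $F$ such that the induced subgraph $G[F]$ has maximum degree at most $1$; the dissociation number $\psi(G)$ is the maximum cardinality of a dissociation set of $G$. Attaching a $P_5$ to a tree $T$: choose a vertex $u$ of $T$ and form the tree $T'$ with $V(T')=V(T)\cup\{x,y,z,j,k\}$ (five new vertices) and $E(T')=E(T)\cup\{uz,zy,zj,yx,jk\}$. -}

module Defs where

open import Data.Bool using (Bool; true; false; _∨_)
open import Data.Bool.Properties using (∨-comm)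
open import Data.Fin using (Fin; splitAt; _≟_)
open import Data.Fin.Patterns using (0F; 1F; 2F; 3F; 4F)
open import Data.Fin.Properties using (all?)
open import Data.Fin.Subset using (Subset; inside; outside; _∈_; _∩_; ∣_∣) renaming (⊥ to ∅)
open import Data.Fin.Subset.Properties using (_∈?_; ∉⊥)
open import Data.List using (List; []; _∷_; _++_; _∷ʳ_; map; filter; length)
open import Data.List.Extrema.Nat using (argmax; argmax-all; f[xs]≤f[argmax])
open import Data.List.Membership.Propositional using () renaming (_∈_ to _∈ˡ_)
open import Data.List.Membership.Propositional.Properties using (∈-++⁺ˡ; ∈-++⁺ʳ; ∈-map⁺; ∈-filter⁺)
open import Data.List.Relation.Unary.All as All using ()
open import Data.List.Relation.Unary.All.Properties using (all-filter)
open import Data.List.Relation.Unary.Any using (here)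
open import Data.List.Relation.Unary.Linked using (Linked)
open import Data.List.Relation.Unary.Unique.Propositional using (Unique)
open import Data.Nat using (ℕ; zero; suc; _+_; _≤_; _≤?_; NonZero)
open import Data.Product using (_×_; _,_; ∃-syntax)
open import Data.Sum using (_⊎_; inj₁; inj₂)
open import Data.Vec using (tabulate; []; _∷_)
open import Function using (_∘_)
open import Function.Bundles using (_↔_; Inverse)
open import Relation.Binary.Construct.Closure.ReflexiveTransitive using (Star)
open import Relation.Binary.PropositionalEquality using (_≡_; refl)
open import Relation.Nullary using (¬_; Dec; does; contradiction)
open import Relation.Nullary.Decidable using (_→-dec_)

record Graph (n : ℕ) : Set where
  field
    adj        : Fin n → Fin n → Bool
    adj-sym    : ∀ u v → adj u v ≡ adj v u
    adj-irrefl : ∀ v → adj v v ≡ false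

  Adj : Fin n → Fin n → Set
  Adj u v = adj u v ≡ true

  neighbourhood : Fin n → Subset n
  neighbourhood v = tabulate (adj v)

  degree : Fin n → ℕ
  degree v = ∣ neighbourhood v ∣

  -- For v ∈ F this is the degree of v in the induced subgraph G[F].
  degreeIn : Subset n → Fin n → ℕ
  degreeIn F v = ∣ neighbourhood v ∩ F ∣

  -- The cycle u – ps – w – u, with at least 3 vertices, all distinct.
  IsCycle : Fin n → List (Fin n) → Fin n → Set
  IsCycle u ps w = 1 ≤ length ps × Unique (u ∷ ps ∷ʳ w) × Linked Adj (u ∷ ps ∷ʳ w) × Adj w u

  Acyclic : Set
  Acyclic = ¬ (∃[ u ] ∃[ ps ] ∃[ w ] IsCycle u ps w)

  Connected : Set
  Connected = NonZero n × (∀ u v → Star Adj u v)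

  IsTree : Set
  IsTree = Connected × Acyclic

  Subcubic : Set
  Subcubic = ∀ v → degree v ≤ 3

  IsDissociationSet : Subset n → Set
  IsDissociationSet F = ∀ v → v ∈ F → degreeIn F v ≤ 1

  isDissociationSet? : ∀ F → Dec (IsDissociationSet F)
  isDissociationSet? F = all? λ v → (v ∈? F) →-dec (degreeIn F v ≤? 1)

open Graph

subsets : ∀ n → List (Subset n)
subsets zero    = [] ∷ []
subsets (suc n) = map (inside ∷_) (subsets n) ++ map (outside ∷_) (subsets n)

maximumDissociationSet : ∀ {n} → Graph n → Subset n
maximumDissociationSet {n} G = argmax ∣_∣ ∅ (filter (isDissociationSet? G) (subsets n))

ψ : ∀ {n} → Graph n → ℕ
ψ G = ∣ maximumDissociationSet G ∣

∈-subsets : ∀ {n} (F : Subset n) → F ∈ˡ subsets n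
∈-subsets []            = here refl
∈-subsets (inside  ∷ F) = ∈-++⁺ˡ (∈-map⁺ (inside ∷_) (∈-subsets F))
∈-subsets (outside ∷ F) = ∈-++⁺ʳ (map (inside ∷_) (subsets _)) (∈-map⁺ (outside ∷_) (∈-subsets F))

maximumDissociationSet-isDissociationSet : ∀ {n} (G : Graph n) → IsDissociationSet G (maximumDissociationSet G)
maximumDissociationSet-isDissociationSet {n} G =
  argmax-all ∣_∣ {P = IsDissociationSet G} (λ v v∈∅ → contradiction v∈∅ ∉⊥)
    (all-filter (isDissociationSet? G) (subsets n))

∣F∣≤ψ : ∀ {n} (G : Graph n) {F} → IsDissociationSet G F → ∣ F ∣ ≤ ψ G
∣F∣≤ψ {n} G {F} d =
  All.lookup (f[xs]≤f[argmax] {f = ∣_∣} ∅ (filter (isDissociationSet? G) (subsets n)))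
    (∈-filter⁺ (isDissociationSet? G) (∈-subsets F) d)

infix 4 _≅_

record _≅_ {m n} (G : Graph m) (H : Graph n) : Set where
  field
    bijection : Fin m ↔ Fin n
    preserves : ∀ u v → adj H (Inverse.to bijection u) (Inverse.to bijection v) ≡ adj G u v

K₂ : Graph 2
K₂ = record { adj = e ; adj-sym = s ; adj-irrefl = i }
  where
  e : Fin 2 → Fin 2 → Bool
  e 0F 1F = true
  e 1F 0F = true
  e 0F 0F = false
  e 1F 1F = false

  s : ∀ u v → e u v ≡ e v u
  s 0F 0F = refl
  s 0F 1F = refl
  s 1F 0F = refl
  s 1F 1F = refl

  i : ∀ v → e v v ≡ false
  i 0F = refl
  i 1F = refl

-- The new vertices x, y, z, j, k are 0F, 1F, 2F, 3F, 4F : Fin 5, and the new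
-- edges uz, zy, zj, yx, jk are listed in this orientation.
newEdge : ∀ {n} → Fin n → Fin n ⊎ Fin 5 → Fin n ⊎ Fin 5 → Bool
newEdge u (inj₁ v)  (inj₂ 2F) = does (v ≟ u)
newEdge u (inj₂ 2F) (inj₂ 1F) = true
newEdge u (inj₂ 2F) (inj₂ 3F) = true
newEdge u (inj₂ 1F) (inj₂ 0F) = true
newEdge u (inj₂ 3F) (inj₂ 4F) = true
newEdge u _         _         = false

attachAdj : ∀ {n} → Graph n → Fin n → Fin n ⊎ Fin 5 → Fin n ⊎ Fin 5 → Bool
attachAdj G u (inj₁ v) (inj₁ w) = adj G v w
attachAdj G u a        b        = newEdge u a b ∨ newEdge u b a

attachAdj-sym : ∀ {n} (G : Graph n) u a b → attachAdj G u a b ≡ attachAdj G u b a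
attachAdj-sym G u (inj₁ v) (inj₁ w) = adj-sym G v w
attachAdj-sym G u (inj₁ v) (inj₂ q) = ∨-comm (newEdge u (inj₁ v) (inj₂ q)) _
attachAdj-sym G u (inj₂ p) (inj₁ w) = ∨-comm (newEdge u (inj₂ p) (inj₁ w)) _
attachAdj-sym G u (inj₂ p) (inj₂ q) = ∨-comm (newEdge u (inj₂ p) (inj₂ q)) _

attachAdj-irrefl : ∀ {n} (G : Graph n) u a → attachAdj G u a a ≡ false
attachAdj-irrefl G u (inj₁ v)  = adj-irrefl G v
attachAdj-irrefl G u (inj₂ 0F) = refl
attachAdj-irrefl G u (inj₂ 1F) = refl
attachAdj-irrefl G u (inj₂ 2F) = refl
attachAdj-irrefl G u (inj₂ 3F) = refl
attachAdj-irrefl G u (inj₂ 4F) = refl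

attachP₅ : ∀ {n} → Graph n → Fin n → Graph (n + 5)
attachP₅ {n} G u = record
  { adj        = λ a b → attachAdj G u (splitAt n a) (splitAt n b)
  ; adj-sym    = λ a b → attachAdj-sym G u (splitAt n a) (splitAt n b)
  ; adj-irrefl = attachAdj-irrefl G u ∘ splitAt n
  }

data ArisesFromK₂ : ∀ {n} → Graph n → Set where
  base   : ArisesFromK₂ K₂
  attach : ∀ {n} {G : Graph n} → ArisesFromK₂ G → (u : Fin n) → ArisesFromK₂ (attachP₅ G u)
  resp-≅ : ∀ {m n} {G : Graph m} {H : Graph n} → G ≅ H → ArisesFromK₂ G → ArisesFromK₂ H

{-# OPTIONS --safe #-}

-- Let F be a dissociation set.  Starting from a component of T[F], grow a set S
-- that contains every F-neighbour of its elements: while S is not everything,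
-- connectedness gives an edge uz leaving S; closure forces z ∉ F, and z has at most
-- two neighbours besides u.  Adding z, its F-neighbours outside S and their partners
-- in F adds one vertex outside F and at most four in F, so |F| ≤ 4 (n - |F|) + 2.
-- If equality holds then the start is a K₂ and every step adds exactly five
-- vertices, which form a P₅ attached at u: the F-vertices added have no neighbour in
-- S by closure, and z has no further neighbour by its degree.
-- Conversely, attaching a P₅ extends a dissociation set by x, y, j, k.

module Submission where

open import Defs
open import Data.Bool using (true; false)
open import Data.Bool.Properties using (¬-not) renaming (_≟_ to _≟ᵇ_)
open import Data.Fin using (Fin; splitAt; _↑ˡ_; _↑ʳ_; _≟_)
open import Data.Fin.Patterns using (0F; 1F; 2F; 3F; 4F)
open import Data.Fin.Permutation using (↔⇒≡)
open import Data.Fin.Properties using (any?; splitAt-↑ˡ; splitAt-↑ʳ; join-splitAt; ↑ˡ-injective; ↑ʳ-injective)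
open import Data.Fin.Subset using (Subset; inside; outside; ⁅_⁆; ∁; _∪_; _∩_; _-_; ∣_∣) renaming (⊥ to ∅; ⊤ to full; _∈_ to _∈ₛ_; _∉_ to _∉ₛ_)
open import Data.Fin.Subset.Properties
  using (nonempty?; Empty-unique; p⊆q⇒∣p∣≤∣q∣; ∣p∣≤n; ∣⊥∣≡0; ∣⁅x⁆∣≡1; ∣∁p∣≡n∸∣p∣; x∈⁅x⁆; x∈⁅y⁆⇒x≡y;
         x∈p∧x≢y⇒x∈p-y; x∈p⇒∣p-x∣<∣p∣; x∈p∪q⁺; x∈p∪q⁻; x∈p∩q⁺; x∈p∩q⁻; x∉p⇒x∈∁p; p─q⊆p; ∉⊥; ∈⊤)
  renaming (_∈?_ to _∈ₛ?_)
import Data.Integer as ℤ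
import Data.Integer.Properties as ℤ
open import Data.List using (List; []; _∷_; _++_; map; filter; length; concatMap; allFin)
open import Data.List.Properties using (length-map; length-++)
open import Data.List.Membership.Propositional using (_∈_; _∉_; find; lose)
open import Data.List.Membership.Propositional.Properties
  using (∈-++⁺ˡ; ∈-++⁺ʳ; ∈-++⁻; ∈-map⁻; ∈-filter⁺; ∈-filter⁻; ∈-allFin; ∈-concatMap⁺; ∈-concatMap⁻)
open import Data.List.Relation.Unary.All as All using (All; []; _∷_)
open import Data.List.Relation.Unary.All.Properties using (¬Any⇒All¬; ++⁻ˡ)
open import Data.List.Relation.Unary.AllPairs as AllPairs using ([]; _∷_)
open import Data.List.Relation.Unary.Any using (here; there)
open import Data.List.Relation.Unary.Unique.Propositional using (Unique)
open import Data.List.Relation.Unary.Unique.Propositional.Properties using (map⁺; ++⁺; filter⁺; allFin⁺)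
open import Data.Nat using (ℕ; zero; suc; _+_; _*_; _<_; z≤n; s≤s)
import Data.Nat as ℕ
open import Data.Nat.Properties
  using (≤-reflexive; ≤-trans; ≤-antisym; <-irrefl; +-mono-≤; +-monoˡ-≤; +-monoʳ-≤; *-monoˡ-≤; *-monoʳ-≤; +-cancelʳ-≤;
         +-cancelˡ-≡; +-suc; +-comm; m≤n⇒m≤1+n; m∸n+n≡m; m≤m+n; module ≤-Reasoning)
open import Data.Nat.Tactic.RingSolver using (solve-∀)
open import Data.Product using (_×_; _,_; proj₁; proj₂; ∃-syntax)
open import Data.Rational using (_/_; _≤_)
open import Data.Rational.Properties using (toℚᵘ-fromℚᵘ; toℚᵘ-cancel-≤; fromℚᵘ-cong; fromℚᵘ-injective)
open import Data.Rational.Unnormalised using (ℚᵘ; mkℚᵘ; *≤*; *≡*)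
import Data.Rational.Unnormalised.Properties as ℚᵘ
open import Data.Sum using (_⊎_; inj₁; inj₂; [_,_]′)
open import Data.Vec as Vec using ([]; _∷_)
open import Data.Vec.Properties using (lookup∘tabulate; lookup⇒[]=; []=⇒lookup)
import Data.Vec.Relation.Unary.All as AllV
import Data.Vec.Relation.Unary.AllPairs as AllPairsV
import Data.Vec.Relation.Unary.Unique.Propositional as Vec
import Data.Vec.Relation.Unary.Unique.Propositional.Properties as Vec
open import Function using (_∘_; id; case_of_)
open import Function.Bundles using (_⇔_; mk⇔; mk↔ₛ′; Inverse; Injection; Equivalence)
open import Function.Properties.Inverse using (Inverse⇒Injection)
open import Level using (0ℓ)
open import Relation.Binary.Construct.Closure.ReflexiveTransitive using (Star; ε; _◅_)
open import Relation.Binary.PropositionalEquality using (_≡_; _≢_; refl; sym; trans; cong; cong₂; subst; subst₂; ≢-sym; module ≡-Reasoning)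
open import Relation.Nullary using (¬_; Dec; yes; no; contradiction)
open import Relation.Nullary.Decidable using (_×-dec_; _⊎-dec_; ¬?)
open import Relation.Unary using (Pred)

-- Lists and cardinalities of subsets

module _ {n : ℕ} where
  open import Data.List.Membership.DecPropositional (_≟_ {n}) public using (_∈?_)

∣p∪q∣≤∣p∣+∣q∣ : ∀ {n} (p q : Subset n) → ∣ p ∪ q ∣ ℕ.≤ ∣ p ∣ + ∣ q ∣
∣p∪q∣≤∣p∣+∣q∣ []            []            = z≤n
∣p∪q∣≤∣p∣+∣q∣ (outside ∷ p) (outside ∷ q) = ∣p∪q∣≤∣p∣+∣q∣ p q
∣p∪q∣≤∣p∣+∣q∣ (outside ∷ p) (inside  ∷ q) rewrite +-suc ∣ p ∣ ∣ q ∣ = s≤s (∣p∪q∣≤∣p∣+∣q∣ p q)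
∣p∪q∣≤∣p∣+∣q∣ (inside  ∷ p) (outside ∷ q) = s≤s (∣p∪q∣≤∣p∣+∣q∣ p q)
∣p∪q∣≤∣p∣+∣q∣ (inside  ∷ p) (inside  ∷ q) rewrite +-suc ∣ p ∣ ∣ q ∣ = s≤s (m≤n⇒m≤1+n (∣p∪q∣≤∣p∣+∣q∣ p q))

∣p∣≤1+∣p-x∣ : ∀ {n} (p : Subset n) x → ∣ p ∣ ℕ.≤ suc ∣ p - x ∣
∣p∣≤1+∣p-x∣ p x = begin
  ∣ p ∣                 ≤⟨ p⊆q⇒∣p∣≤∣q∣ p⊆ ⟩
  ∣ ⁅ x ⁆ ∪ (p - x) ∣   ≤⟨ ∣p∪q∣≤∣p∣+∣q∣ ⁅ x ⁆ (p - x) ⟩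
  ∣ ⁅ x ⁆ ∣ + ∣ p - x ∣ ≡⟨ cong (_+ ∣ p - x ∣) (∣⁅x⁆∣≡1 x) ⟩
  suc ∣ p - x ∣         ∎
  where
  open ≤-Reasoning
  p⊆ : ∀ {y} → y ∈ₛ p → y ∈ₛ ⁅ x ⁆ ∪ (p - x)
  p⊆ {y} y∈p with y ≟ x
  ... | yes refl = x∈p∪q⁺ (inj₁ (x∈⁅x⁆ x))
  ... | no  y≢x  = x∈p∪q⁺ (inj₂ (x∈p∧x≢y⇒x∈p-y y∈p y≢x))

y∉p-y : ∀ {n} (p : Subset n) y → y ∉ₛ p - y
y∉p-y (x ∷ p) Fin.zero    y∈ with () ← []=⇒lookup y∈
y∉p-y (x ∷ p) (Fin.suc y) (Vec.there y∈) = y∉p-y p y y∈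

remove-∈ : ∀ {n} {p : Subset n} {x xs} → (∀ {y} → y ∈ₛ p → y ∈ x ∷ xs) → ∀ {y} → y ∈ₛ p - x → y ∈ xs
remove-∈ {p = p} {x} p⊆ {y} y∈ with p⊆ (p─q⊆p p ⁅ x ⁆ y∈)
... | here refl = contradiction y∈ (y∉p-y p x)
... | there y∈xs = y∈xs

⊆⇒∣p∣≤length : ∀ {n} {p : Subset n} xs → (∀ {y} → y ∈ₛ p → y ∈ xs) → ∣ p ∣ ℕ.≤ length xs
⊆⇒∣p∣≤length {n} {p} [] p⊆ = ≤-reflexive (trans (cong ∣_∣ (Empty-unique λ (_ , y∈) → case p⊆ y∈ of λ ())) (∣⊥∣≡0 n))
⊆⇒∣p∣≤length {p = p} (x ∷ xs) p⊆ = ≤-trans (∣p∣≤1+∣p-x∣ p x) (s≤s (⊆⇒∣p∣≤length xs (remove-∈ p⊆)))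

unique⇒length≤∣p∣ : ∀ {n} {p : Subset n} {xs} → Unique xs → (∀ {y} → y ∈ xs → y ∈ₛ p) → length xs ℕ.≤ ∣ p ∣
unique⇒length≤∣p∣ [] ⊆p = z≤n
unique⇒length≤∣p∣ (x≢ ∷ u) ⊆p =
  ≤-trans (s≤s (unique⇒length≤∣p∣ u λ y∈ → x∈p∧x≢y⇒x∈p-y (⊆p (there y∈)) (≢-sym (All.lookup x≢ y∈))))
          (x∈p⇒∣p-x∣<∣p∣ (⊆p (here refl)))

unique⇒length≤n : ∀ {n} {xs : List (Fin n)} → Unique xs → length xs ℕ.≤ n
unique⇒length≤n u = ≤-trans (unique⇒length≤∣p∣ u (λ _ → ∈⊤)) (∣p∣≤n full)

-- A repeated head could be dropped: the tail would still cover `p`, making `∣ p ∣` smaller than the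
-- length of the list. In the equality case this shows that `ls` has no repetitions.
tight⇒unique : ∀ {n} {p : Subset n} xs → (∀ {y} → y ∈ₛ p → y ∈ xs) → length xs ℕ.≤ ∣ p ∣ → Unique xs
tight⇒unique [] p⊆ len≤ = []
tight⇒unique {p = p} (x ∷ xs) p⊆ len≤ =
  ¬Any⇒All¬ xs x∉xs ∷ tight⇒unique xs (remove-∈ p⊆) (ℕ.s≤s⁻¹ (≤-trans len≤ (∣p∣≤1+∣p-x∣ p x)))
  where
  x∉xs : x ∉ xs
  x∉xs x∈xs = <-irrefl refl (≤-trans len≤ (⊆⇒∣p∣≤length xs λ y∈ → case p⊆ y∈ of λ where
    (here refl) → x∈xs
    (there y∈)  → y∈))

unique-++⁻ : ∀ {a} {A : Set a} (xs {ys} : List A) → Unique (xs ++ ys) → Unique xs × Unique ys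
unique-++⁻ []       u        = [] , u
unique-++⁻ (x ∷ xs) (x≢ ∷ u) = let uˡ , uʳ = unique-++⁻ xs u in ++⁻ˡ xs x≢ ∷ uˡ , uʳ

elements : ∀ {n} → Subset n → List (Fin n)
elements {n} p = filter (_∈ₛ? p) (allFin n)

elements-unique : ∀ {n} (p : Subset n) → Unique (elements p)
elements-unique {n} p = filter⁺ (_∈ₛ? p) (allFin⁺ n)

∈-elements⁺ : ∀ {n} {p : Subset n} {v} → v ∈ₛ p → v ∈ elements p
∈-elements⁺ {p = p} {v} = ∈-filter⁺ (_∈ₛ? p) (∈-allFin v)

∈-elements⁻ : ∀ {n} {p : Subset n} {v} → v ∈ elements p → v ∈ₛ p
∈-elements⁻ {p = p} v∈ = proj₂ (∈-filter⁻ (_∈ₛ? p) {xs = allFin _} v∈)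

length-elements≤ : ∀ {n} (p : Subset n) → length (elements p) ℕ.≤ ∣ p ∣
length-elements≤ p = unique⇒length≤∣p∣ (elements-unique p) ∈-elements⁻

∣p∣≤1⇒≡ : ∀ {n} {p : Subset n} {v w} → ∣ p ∣ ℕ.≤ 1 → v ∈ₛ p → w ∈ₛ p → v ≡ w
∣p∣≤1⇒≡ {v = v} {w} p≤1 v∈ w∈ with v ≟ w
... | yes v≡w = v≡w
... | no  v≢w = case ≤-trans (unique⇒length≤∣p∣ ((v≢w ∷ []) ∷ [] ∷ []) λ { (here refl) → v∈ ; (there (here refl)) → w∈ }) p≤1 of λ { (s≤s ()) }

≡⇒∣p∣≤1 : ∀ {n} {p : Subset n} → (∀ {v w} → v ∈ₛ p → w ∈ₛ p → v ≡ w) → ∣ p ∣ ℕ.≤ 1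
≡⇒∣p∣≤1 {n} {p} all≡ with nonempty? p
... | yes (v , v∈) = ⊆⇒∣p∣≤length (v ∷ []) λ w∈ → here (all≡ w∈ v∈)
... | no  p≡∅      = subst (ℕ._≤ 1) (sym (trans (cong ∣_∣ (Empty-unique p≡∅)) (∣⊥∣≡0 n))) z≤n

fromList : ∀ {n} → List (Fin n) → Subset n
fromList []       = ∅
fromList (x ∷ xs) = ⁅ x ⁆ ∪ fromList xs

∈-fromList⁺ : ∀ {n} {v : Fin n} {xs} → v ∈ xs → v ∈ₛ fromList xs
∈-fromList⁺ (here refl) = x∈p∪q⁺ (inj₁ (x∈⁅x⁆ _))
∈-fromList⁺ (there v∈)  = x∈p∪q⁺ (inj₂ (∈-fromList⁺ v∈))

∈-fromList⁻ : ∀ {n} {v : Fin n} xs → v ∈ₛ fromList xs → v ∈ xs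
∈-fromList⁻ []       v∈ = contradiction v∈ ∉⊥
∈-fromList⁻ (x ∷ xs) v∈ with x∈p∪q⁻ ⁅ x ⁆ (fromList xs) v∈
... | inj₁ v∈x  = here (x∈⁅y⁆⇒x≡y x v∈x)
... | inj₂ v∈xs = there (∈-fromList⁻ xs v∈xs)

-- Separates equality in the accumulated count into equality for the last growth step and equality
-- for the earlier ones.
+-split-≡ : ∀ {a b c d} → a ℕ.≤ c → b ℕ.≤ d → a + b ≡ c + d → a ≡ c × b ≡ d
+-split-≡ {a} {b} {c} {d} a≤c b≤d eq = a≡c , +-cancelˡ-≡ c b d (trans (cong (_+ b) (sym a≡c)) eq)
  where
  a≡c : a ≡ c
  a≡c = ≤-antisym a≤c (+-cancelʳ-≤ d c a (≤-trans (≤-reflexive (sym eq)) (+-monoʳ-≤ a b≤d)))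

-- Lists of vertices together with their mates

module _ {a} {A : Set a} (f : A → List A) where

  withMates : List A → List A
  withMates = concatMap λ y → y ∷ f y

  length-withMates≤ : ∀ {ys} → All (λ y → length (f y) ℕ.≤ 1) ys → length (withMates ys) ℕ.≤ length ys * 2
  length-withMates≤ [] = z≤n
  length-withMates≤ {y ∷ ys} (le ∷ les) =
    ≤-trans (≤-reflexive (length-++ (y ∷ f y))) (+-mono-≤ (s≤s le) (length-withMates≤ les))

  -- Four is the largest possible length, so every bound is attained: two entries, each with exactly
  -- one mate. In a growth step these are y, j and their partners x, k.
  withMates-four : ∀ ys → All (λ y → length (f y) ℕ.≤ 1) ys → length ys ℕ.≤ 2 → length (withMates ys) ≡ 4 →
                   ∃[ y ] ∃[ j ] ∃[ x ] ∃[ k ] ys ≡ y ∷ j ∷ [] × f y ≡ x ∷ [] × f j ≡ k ∷ []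
  withMates-four (y ∷ []) (le ∷ []) _ eq with f y
  withMates-four (y ∷ []) (le ∷ []) _ () | []
  withMates-four (y ∷ []) (le ∷ []) _ () | x ∷ []
  withMates-four (y ∷ []) (s≤s () ∷ []) _ eq | x ∷ x′ ∷ _
  withMates-four (y ∷ j ∷ []) (le ∷ le′ ∷ []) _ eq with f y in fy | f j in fj
  withMates-four (y ∷ j ∷ []) (le ∷ le′ ∷ []) _ () | []     | []
  withMates-four (y ∷ j ∷ []) (le ∷ le′ ∷ []) _ () | []     | _ ∷ []
  withMates-four (y ∷ j ∷ []) (le ∷ le′ ∷ []) _ () | _ ∷ [] | []
  withMates-four (y ∷ j ∷ []) (le ∷ le′ ∷ []) _ eq | x ∷ [] | k ∷ [] = y , j , x , k , refl , fy , fj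
  withMates-four (y ∷ j ∷ []) (s≤s () ∷ _) _ eq | _ ∷ _ ∷ _ | _
  withMates-four (y ∷ j ∷ []) (_ ∷ s≤s () ∷ []) _ eq | _ | _ ∷ _ ∷ _
  withMates-four (_ ∷ _ ∷ _ ∷ _) _ (s≤s (s≤s ())) eq

splitAt-injective : ∀ {m n} (a b : Fin (m + n)) → splitAt m a ≡ splitAt m b → a ≡ b
splitAt-injective {m} {n} a b e =
  trans (sym (join-splitAt m n a)) (trans (cong [ _↑ˡ n , m ↑ʳ_ ]′ e) (join-splitAt m n b))

-- Adjacency as membership in neighbourhoods

module _ {n} (T : Graph n) where
  open Graph T

  ∈-neighbourhood⁺ : ∀ {v w} → Adj v w → w ∈ₛ neighbourhood v
  ∈-neighbourhood⁺ {v} {w} vw = lookup⇒[]= w _ (trans (lookup∘tabulate (adj v) w) vw)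

  ∈-neighbourhood⁻ : ∀ {v w} → w ∈ₛ neighbourhood v → Adj v w
  ∈-neighbourhood⁻ {v} {w} w∈ = trans (sym (lookup∘tabulate (adj v) w)) ([]=⇒lookup w∈)

  Adj-sym : ∀ {v w} → Adj v w → Adj w v
  Adj-sym {v} {w} = trans (adj-sym w v)

  Adj⇒≢ : ∀ {v w} → Adj v w → v ≢ w
  Adj⇒≢ {v} vv refl with () ← trans (sym vv) (adj-irrefl v)

  Adj? : ∀ v w → Dec (Adj v w)
  Adj? v w = adj v w ≟ᵇ true

-- Induced subgraphs arising from K₂

-- Says that T[S] is isomorphic to a graph arising from K₂. The embedding keeps the vertices of T
-- under their own names, so S can grow without renumbering.
record Realised {n} (T : Graph n) (S : Pred (Fin n) 0ℓ) : Set where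
  field
    {size}          : ℕ
    {graph}         : Graph size
    arises          : ArisesFromK₂ graph
    embed           : Fin size → Fin n
    embed-injective : ∀ {a b} → embed a ≡ embed b → a ≡ b
    embed-adj       : ∀ a b → Graph.adj T (embed a) (embed b) ≡ Graph.adj graph a b
    embed-∈         : ∀ a → S (embed a)
    covers          : ∀ {v} → S v → ∃[ a ] embed a ≡ v

module _ {n} {T : Graph n} where
  open Graph T

  realised-⊤⇒arises : ∀ {S} → Realised T S → (∀ v → S v) → ArisesFromK₂ T
  realised-⊤⇒arises r all = resp-≅ iso arises
    where
    open Realised r
    iso : graph ≅ T
    iso = record
      { bijection = mk↔ₛ′ embed (λ v → proj₁ (covers (all v))) (λ v → proj₂ (covers (all v)))
                          (λ a → embed-injective (proj₂ (covers (all (embed a)))))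
      ; preserves = embed-adj }

  realised-K₂ : ∀ {S v w} → Adj v w → S v → S w → (∀ {t} → S t → t ≡ v ⊎ t ≡ w) → Realised T S
  realised-K₂ {S} {v} {w} vw Sv Sw only = record
    { arises = base ; embed = f ; embed-injective = f-inj _ _ ; embed-adj = f-adj
    ; embed-∈ = λ { 0F → Sv ; 1F → Sw }
    ; covers = λ St → [ (λ { refl → 0F , refl }) , (λ { refl → 1F , refl }) ]′ (only St) }
    where
    f : Fin 2 → Fin n
    f 0F = v
    f 1F = w
    f-inj : ∀ a b → f a ≡ f b → a ≡ b
    f-inj 0F 0F _ = refl
    f-inj 1F 1F _ = refl
    f-inj 0F 1F e = contradiction e (Adj⇒≢ T vw)
    f-inj 1F 0F e = contradiction (sym e) (Adj⇒≢ T vw)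
    f-adj : ∀ a b → adj (f a) (f b) ≡ Graph.adj K₂ a b
    f-adj 0F 0F = adj-irrefl v
    f-adj 0F 1F = vw
    f-adj 1F 0F = Adj-sym T vw
    f-adj 1F 1F = adj-irrefl w

  -- If five vertices outside S are adjacent to each other and to S as the new vertices of
  -- `attachP₅` at `a₀` are, then the embedding extends to them. It is built on the sum
  -- `Fin size ⊎ Fin 5` and transported along `splitAt`.
  module _ {S S′ : Pred (Fin n) 0ℓ} (r : Realised T S) (a₀ : Fin (Realised.size r)) (new : Vec.Vec (Fin n) 5)
    (new-unique : Vec.Unique new) (new-∉ : ∀ q → ¬ S (Vec.lookup new q))
    (new-adj : ∀ p q → adj (Vec.lookup new p) (Vec.lookup new q) ≡ attachAdj (Realised.graph r) a₀ (inj₂ p) (inj₂ q))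
    (cross-adj : ∀ a q → adj (Realised.embed r a) (Vec.lookup new q) ≡ attachAdj (Realised.graph r) a₀ (inj₁ a) (inj₂ q))
    (S⊆S′ : ∀ {v} → S v → S′ v) (new-∈ : ∀ q → S′ (Vec.lookup new q))
    (S′⊆ : ∀ {v} → S′ v → S v ⊎ ∃[ q ] Vec.lookup new q ≡ v) where

    open Realised r

    private
      f : Fin size ⊎ Fin 5 → Fin n
      f = [ embed , Vec.lookup new ]′

      f-inj : ∀ s t → f s ≡ f t → s ≡ t
      f-inj (inj₁ a) (inj₁ b) e = cong inj₁ (embed-injective e)
      f-inj (inj₁ a) (inj₂ q) e = contradiction (subst S e (embed-∈ a)) (new-∉ q)
      f-inj (inj₂ p) (inj₁ b) e = contradiction (subst S (sym e) (embed-∈ b)) (new-∉ p)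
      f-inj (inj₂ p) (inj₂ q) e = cong inj₂ (Vec.lookup-injective new-unique p q e)

      f-adj : ∀ s t → adj (f s) (f t) ≡ attachAdj graph a₀ s t
      f-adj (inj₁ a) (inj₁ b) = embed-adj a b
      f-adj (inj₁ a) (inj₂ q) = cross-adj a q
      f-adj (inj₂ p) (inj₁ b) = trans (adj-sym _ _) (trans (cross-adj b p) (attachAdj-sym graph a₀ (inj₁ b) (inj₂ p)))
      f-adj (inj₂ p) (inj₂ q) = new-adj p q

      f-∈ : ∀ s → S′ (f s)
      f-∈ (inj₁ a) = S⊆S′ (embed-∈ a)
      f-∈ (inj₂ q) = new-∈ q

      f-covers : ∀ {v} → S′ v → ∃[ a ] f (splitAt size a) ≡ v
      f-covers S′v with S′⊆ S′v
      ... | inj₁ Sv      = let a , e = covers Sv in a ↑ˡ 5 , trans (cong f (splitAt-↑ˡ size a 5)) e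
      ... | inj₂ (q , e) = size ↑ʳ q , trans (cong f (splitAt-↑ʳ size 5 q)) e

    realised-attach : Realised T S′
    realised-attach = record
      { arises = attach arises a₀
      ; embed = f ∘ splitAt size
      ; embed-injective = λ {a} {b} e → splitAt-injective a b (f-inj _ _ e)
      ; embed-adj = λ a b → f-adj (splitAt size a) (splitAt size b)
      ; embed-∈ = λ a → f-∈ (splitAt size a)
      ; covers = f-covers }

-- Growing a set closed under neighbours in F

module Growth {n} (T : Graph n) (subcubic : Graph.Subcubic T) (connected : ∀ u v → Star (Graph.Adj T) u v)
              (F : Subset n) (dissoc : Graph.IsDissociationSet T F) where
  open Graph T

  nbrsIn : Fin n → List (Fin n)
  nbrsIn v = elements (neighbourhood v ∩ F)

  ∈-nbrsIn⁺ : ∀ {v w} → Adj v w → w ∈ₛ F → w ∈ nbrsIn v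
  ∈-nbrsIn⁺ vw w∈F = ∈-elements⁺ (x∈p∩q⁺ (∈-neighbourhood⁺ T vw , w∈F))

  ∈-nbrsIn⁻ : ∀ {v w} → w ∈ nbrsIn v → Adj v w × w ∈ₛ F
  ∈-nbrsIn⁻ {v} w∈ = let w∈N , w∈F = x∈p∩q⁻ (neighbourhood v) F (∈-elements⁻ w∈) in ∈-neighbourhood⁻ T w∈N , w∈F

  length-nbrsIn≤1 : ∀ {v} → v ∈ₛ F → length (nbrsIn v) ℕ.≤ 1
  length-nbrsIn≤1 {v} v∈F = ≤-trans (length-elements≤ (neighbourhood v ∩ F)) (dissoc v v∈F)

  mate-unique : ∀ {v w w′} → v ∈ₛ F → w ∈ₛ F → w′ ∈ₛ F → Adj v w → Adj v w′ → w ≡ w′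
  mate-unique {v} v∈ w∈ w′∈ vw vw′ =
    ∣p∣≤1⇒≡ (dissoc v v∈) (x∈p∩q⁺ (∈-neighbourhood⁺ T vw , w∈)) (x∈p∩q⁺ (∈-neighbourhood⁺ T vw′ , w′∈))

  neighbours≤3 : ∀ {v xs} → Unique xs → (∀ {w} → w ∈ xs → Adj v w) → length xs ℕ.≤ 3
  neighbours≤3 {v} u adj-v = ≤-trans (unique⇒length≤∣p∣ u (∈-neighbourhood⁺ T ∘ adj-v)) (subcubic v)

  infix 4 _∈ˢ_
  _∈ˢ_ : Fin n → List (Fin n) × List (Fin n) → Set
  v ∈ˢ (ls , zs) = v ∈ ls ⊎ v ∈ zs

  _∈ˢ?_ : ∀ v S → Dec (v ∈ˢ S)
  v ∈ˢ? (ls , zs) = (v ∈? ls) ⊎-dec (v ∈? zs)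

  -- Here `v` ranges over all of S, including its part outside F. Hence every edge leaving S ends
  -- outside F, and an F-vertex outside S has no neighbour in S at all.
  Closed : List (Fin n) × List (Fin n) → Set
  Closed S = ∀ {v w} → v ∈ˢ S → Adj v w → w ∈ₛ F → w ∈ˢ S

  -- ls covers the part of S inside F, possibly with repetitions; zs lists the part outside F.
  record State : Set where
    field
      ls zs     : List (Fin n)
    S : List (Fin n) × List (Fin n)
    S = ls , zs
    field
      zs-unique : Unique zs
      zs-∉F     : ∀ {v} → v ∈ zs → v ∉ₛ F
      closed    : Closed S
      -- The 2 pays for the starting component of T[F], and each vertex of `zs` pays for the at most
      -- four entries added along with it.
      length≤   : length ls ℕ.≤ 2 + length zs * 4
      -- Uniqueness is assumed here because it only becomes available at the end, when `ls` is
      -- compared with all of F.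
      tight     : length ls ≡ 2 + length zs * 4 → Unique ls → Realised T (_∈ˢ S)
      root      : ∃[ v ] v ∈ˢ S

  module Step (st : State) {u z : Fin n} (u∈S : u ∈ˢ State.S st) (z∉S : ¬ z ∈ˢ State.S st) (uz : Adj u z) where
    open State st

    z∉F : z ∉ₛ F
    z∉F z∈F = z∉S (closed u∈S uz z∈F)

    fresh block : List (Fin n)
    fresh = filter (λ y → ¬? (y ∈ˢ? S)) (nbrsIn z)
    block = withMates nbrsIn fresh

    ∈-fresh⁻ : ∀ {y} → y ∈ fresh → Adj z y × y ∈ₛ F × ¬ y ∈ˢ S
    ∈-fresh⁻ y∈ = let y∈N , y∉S = ∈-filter⁻ (λ y → ¬? (y ∈ˢ? S)) {xs = nbrsIn z} y∈
                      zy , y∈F  = ∈-nbrsIn⁻ y∈N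
                  in zy , y∈F , y∉S

    fresh-unique : Unique fresh
    fresh-unique = filter⁺ (λ y → ¬? (y ∈ˢ? S)) (elements-unique _)

    -- The neighbour u of z lies in S and the fresh ones do not, so u uses up one of the three
    -- places at z.
    length-fresh≤2 : length fresh ℕ.≤ 2
    length-fresh≤2 = ℕ.s≤s⁻¹ (neighbours≤3 {z} {u ∷ fresh} (¬Any⇒All¬ fresh u∉ ∷ fresh-unique) λ where
        (here refl) → Adj-sym T uz
        (there y∈)  → proj₁ (∈-fresh⁻ y∈))
      where
      u∉ : u ∉ fresh
      u∉ u∈ = proj₂ (proj₂ (∈-fresh⁻ u∈)) u∈S

    fresh-mates≤1 : All (λ y → length (nbrsIn y) ℕ.≤ 1) fresh
    fresh-mates≤1 = All.tabulate λ y∈ → length-nbrsIn≤1 (proj₁ (proj₂ (∈-fresh⁻ y∈)))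

    length-block≤4 : length block ℕ.≤ 4
    length-block≤4 = ≤-trans (length-withMates≤ nbrsIn fresh-mates≤1) (*-monoˡ-≤ 2 length-fresh≤2)

    S′ : List (Fin n) × List (Fin n)
    S′ = block ++ ls , z ∷ zs

    S⊆S′ : ∀ {v} → v ∈ˢ S → v ∈ˢ S′
    S⊆S′ (inj₁ v∈) = inj₁ (∈-++⁺ʳ block v∈)
    S⊆S′ (inj₂ v∈) = inj₂ (there v∈)

    block⊆S′ : ∀ {v} → v ∈ block → v ∈ˢ S′
    block⊆S′ v∈ = inj₁ (∈-++⁺ˡ v∈)

    S′⊆ : ∀ {v} → v ∈ˢ S′ → v ∈ˢ S ⊎ v ≡ z ⊎ v ∈ block
    S′⊆ (inj₁ v∈) = [ inj₂ ∘ inj₂ , inj₁ ∘ inj₁ ]′ (∈-++⁻ block v∈)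
    S′⊆ (inj₂ (here v≡z))  = inj₂ (inj₁ v≡z)
    S′⊆ (inj₂ (there v∈)) = inj₁ (inj₂ v∈)

    ∈-block⁺ : ∀ {v y} → y ∈ fresh → v ∈ y ∷ nbrsIn y → v ∈ block
    ∈-block⁺ {v} y∈ v∈ = ∈-concatMap⁺ (λ y → y ∷ nbrsIn y) (lose y∈ v∈)

    -- An F-neighbour of z is in S or fresh, the F-neighbours of a fresh vertex are listed right
    -- after it, and a partner has no F-neighbour except its fresh vertex.
    closed′ : Closed S′
    closed′ {v} {w} v∈ vw w∈F with S′⊆ v∈
    ... | inj₁ v∈S = S⊆S′ (closed v∈S vw w∈F)
    ... | inj₂ (inj₁ refl) with w ∈ˢ? S
    ...   | yes w∈S = S⊆S′ w∈S
    ...   | no  w∉S =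
      block⊆S′ (∈-block⁺ (∈-filter⁺ (λ y → ¬? (y ∈ˢ? S)) (∈-nbrsIn⁺ vw w∈F) w∉S) (here refl))
    closed′ {v} {w} v∈ vw w∈F | inj₂ (inj₂ v∈block) with find (∈-concatMap⁻ (λ y → y ∷ nbrsIn y) {xs = fresh} v∈block)
    ... | y , y∈ , here refl = block⊆S′ (∈-block⁺ y∈ (there (∈-nbrsIn⁺ vw w∈F)))
    ... | y , y∈ , there v∈N = let yv , v∈F = ∈-nbrsIn⁻ v∈N in
      block⊆S′ (∈-block⁺ y∈ (here (mate-unique v∈F w∈F (proj₁ (proj₂ (∈-fresh⁻ y∈))) vw (Adj-sym T yv))))

    -- The extremal step: x y z j k is an induced path whose only edge to S is uz.
    module Tight (r : Realised T (_∈ˢ S)) {y j x k : Fin n}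
      (fresh≡ : fresh ≡ y ∷ j ∷ []) (mate-y : nbrsIn y ≡ x ∷ []) (mate-j : nbrsIn j ≡ k ∷ [])
      (distinct : Unique (y ∷ x ∷ j ∷ k ∷ [])) where
      open Realised r

      block≡ : block ≡ y ∷ x ∷ j ∷ k ∷ []
      block≡ rewrite fresh≡ | mate-y | mate-j = refl

      y-fresh : Adj z y × y ∈ₛ F × ¬ y ∈ˢ S
      y-fresh = ∈-fresh⁻ (subst (y ∈_) (sym fresh≡) (here refl))
      j-fresh : Adj z j × j ∈ₛ F × ¬ j ∈ˢ S
      j-fresh = ∈-fresh⁻ (subst (j ∈_) (sym fresh≡) (there (here refl)))
      x-mate : Adj y x × x ∈ₛ F
      x-mate = ∈-nbrsIn⁻ (subst (x ∈_) (sym mate-y) (here refl))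
      k-mate : Adj j k × k ∈ₛ F
      k-mate = ∈-nbrsIn⁻ (subst (k ∈_) (sym mate-j) (here refl))

      zy = proj₁ y-fresh
      zj = proj₁ j-fresh
      yx = proj₁ x-mate
      jk = proj₁ k-mate
      y∈F = proj₁ (proj₂ y-fresh)
      j∈F = proj₁ (proj₂ j-fresh)
      x∈F = proj₂ x-mate
      k∈F = proj₂ k-mate
      y∉S = proj₂ (proj₂ y-fresh)
      j∉S = proj₂ (proj₂ j-fresh)

      -- If the partner x were in S, closure would pull y into S as well; likewise for k and j.
      x∉S : ¬ x ∈ˢ S
      x∉S x∈S = y∉S (closed x∈S (Adj-sym T yx) y∈F)
      k∉S : ¬ k ∈ˢ S
      k∉S k∈S = j∉S (closed k∈S (Adj-sym T jk) j∈F)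

      ∉F-≢ : ∀ {v} → v ∈ₛ F → v ≢ z
      ∉F-≢ v∈F refl = z∉F v∈F

      y≢ : ∀ {v} → v ∈ x ∷ j ∷ k ∷ [] → y ≢ v
      y≢ = All.lookup (AllPairs.head distinct)
      x≢ : ∀ {v} → v ∈ j ∷ k ∷ [] → x ≢ v
      x≢ = All.lookup (AllPairs.head (AllPairs.tail distinct))
      y≢x = y≢ (here refl)
      y≢j = y≢ (there (here refl))
      y≢k = y≢ (there (there (here refl)))
      x≢j = x≢ (here refl)
      x≢k = x≢ (there (here refl))
      j≢k = Adj⇒≢ T jk

      ∉S-≢ : ∀ {v w} → v ∈ˢ S → ¬ w ∈ˢ S → v ≢ w
      ∉S-≢ v∈ w∉ refl = w∉ v∈

      -- The vertices u, y, j are three distinct neighbours of z, and the degree allows no fourth.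
      z-nbrs : ∀ {v} → v ≢ u → v ≢ y → v ≢ j → adj z v ≡ false
      z-nbrs {v} v≢u v≢y v≢j = ¬-not λ zv →
        case neighbours≤3 {z} {v ∷ u ∷ y ∷ j ∷ []}
               ((v≢u ∷ v≢y ∷ v≢j ∷ []) ∷ (∉S-≢ u∈S y∉S ∷ ∉S-≢ u∈S j∉S ∷ []) ∷ (y≢j ∷ []) ∷ [] ∷ [])
               (λ { (here refl) → zv ; (there (here refl)) → Adj-sym T uz
                  ; (there (there (here refl))) → zy ; (there (there (there (here refl)))) → zj })
        of λ { (s≤s (s≤s (s≤s ()))) }

      non-mate : ∀ {v w w′} → v ∈ₛ F → w ∈ₛ F → w′ ∈ₛ F → Adj v w → w ≢ w′ → adj v w′ ≡ false
      non-mate v∈ w∈ w′∈ vw w≢w′ = ¬-not λ vw′ → w≢w′ (mate-unique v∈ w∈ w′∈ vw vw′)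

      S-nonadj : ∀ {v w} → v ∈ˢ S → w ∈ₛ F → ¬ w ∈ˢ S → adj v w ≡ false
      S-nonadj v∈ w∈F w∉ = ¬-not λ vw → w∉ (closed v∈ vw w∈F)

      a₀ : Fin size
      a₀ = proj₁ (covers u∈S)

      embed-a₀ : embed a₀ ≡ u
      embed-a₀ = proj₂ (covers u∈S)

      -- The order agrees with the numbering of x, y, z, j, k by `0F` to `4F` in `newEdge`.
      new : Vec.Vec (Fin n) 5
      new = x ∷ y ∷ z ∷ j ∷ k ∷ []

      new-unique : Vec.Unique new
      new-unique =
        (≢-sym y≢x AllV.∷ ∉F-≢ x∈F AllV.∷ x≢j AllV.∷ x≢k AllV.∷ AllV.[]) AllPairsV.∷
        (∉F-≢ y∈F AllV.∷ y≢j AllV.∷ y≢k AllV.∷ AllV.[]) AllPairsV.∷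
        (≢-sym (∉F-≢ j∈F) AllV.∷ ≢-sym (∉F-≢ k∈F) AllV.∷ AllV.[]) AllPairsV.∷
        (j≢k AllV.∷ AllV.[]) AllPairsV.∷ AllV.[] AllPairsV.∷ AllPairsV.[]

      new-∉ : ∀ q → ¬ Vec.lookup new q ∈ˢ S
      new-∉ 0F = x∉S
      new-∉ 1F = y∉S
      new-∉ 2F = z∉S
      new-∉ 3F = j∉S
      new-∉ 4F = k∉S

      xy = Adj-sym T yx
      xz : adj z x ≡ false
      xz = z-nbrs (≢-sym (∉S-≢ u∈S x∉S)) (≢-sym y≢x) x≢j
      kz : adj z k ≡ false
      kz = z-nbrs (≢-sym (∉S-≢ u∈S k∉S)) (≢-sym y≢k) (≢-sym j≢k)

      -- Non-edges among x, y, j, k hold because each already has its one F-neighbour; non-edges at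
      -- z come from its degree.
      new-adj : ∀ p q → adj (Vec.lookup new p) (Vec.lookup new q) ≡ attachAdj graph a₀ (inj₂ p) (inj₂ q)
      new-adj 0F 0F = adj-irrefl x
      new-adj 0F 1F = xy
      new-adj 0F 2F = trans (adj-sym x z) xz
      new-adj 0F 3F = non-mate x∈F y∈F j∈F xy y≢j
      new-adj 0F 4F = non-mate x∈F y∈F k∈F xy y≢k
      new-adj 1F 0F = yx
      new-adj 1F 1F = adj-irrefl y
      new-adj 1F 2F = Adj-sym T zy
      new-adj 1F 3F = non-mate y∈F x∈F j∈F yx x≢j
      new-adj 1F 4F = non-mate y∈F x∈F k∈F yx x≢k
      new-adj 2F 0F = xz
      new-adj 2F 1F = zy
      new-adj 2F 2F = adj-irrefl z
      new-adj 2F 3F = zj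
      new-adj 2F 4F = kz
      new-adj 3F 0F = non-mate j∈F k∈F x∈F jk (≢-sym x≢k)
      new-adj 3F 1F = non-mate j∈F k∈F y∈F jk (≢-sym y≢k)
      new-adj 3F 2F = Adj-sym T zj
      new-adj 3F 3F = adj-irrefl j
      new-adj 3F 4F = jk
      new-adj 4F 0F = non-mate k∈F j∈F x∈F (Adj-sym T jk) (≢-sym x≢j)
      new-adj 4F 1F = non-mate k∈F j∈F y∈F (Adj-sym T jk) (≢-sym y≢j)
      new-adj 4F 2F = trans (adj-sym k z) kz
      new-adj 4F 3F = Adj-sym T jk
      new-adj 4F 4F = adj-irrefl k

      -- Closure rules out edges from S to x, y, j, k, and the degree of z leaves u as its only
      -- neighbour in S.
      cross-adj : ∀ a q → adj (embed a) (Vec.lookup new q) ≡ attachAdj graph a₀ (inj₁ a) (inj₂ q)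
      cross-adj a 0F = S-nonadj (embed-∈ a) x∈F x∉S
      cross-adj a 1F = S-nonadj (embed-∈ a) y∈F y∉S
      cross-adj a 2F with a ≟ a₀
      ... | yes refl = subst (λ v → Adj v z) (sym embed-a₀) uz
      ... | no  a≢   = trans (adj-sym (embed a) z)
        (z-nbrs (λ e → a≢ (embed-injective (trans e (sym embed-a₀)))) (∉S-≢ (embed-∈ a) y∉S) (∉S-≢ (embed-∈ a) j∉S))
      cross-adj a 3F = S-nonadj (embed-∈ a) j∈F j∉S
      cross-adj a 4F = S-nonadj (embed-∈ a) k∈F k∉S

      in-block : ∀ {v} → v ∈ y ∷ x ∷ j ∷ k ∷ [] → v ∈ˢ S′
      in-block {v} v∈ = block⊆S′ (subst (v ∈_) (sym block≡) v∈)

      new-∈ : ∀ q → Vec.lookup new q ∈ˢ S′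
      new-∈ 0F = in-block (there (here refl))
      new-∈ 1F = in-block (here refl)
      new-∈ 2F = inj₂ (here refl)
      new-∈ 3F = in-block (there (there (here refl)))
      new-∈ 4F = in-block (there (there (there (here refl))))

      block⊆new : ∀ {v} → v ∈ y ∷ x ∷ j ∷ k ∷ [] → ∃[ q ] Vec.lookup new q ≡ v
      block⊆new (here refl)                         = 1F , refl
      block⊆new (there (here refl))                 = 0F , refl
      block⊆new (there (there (here refl)))         = 3F , refl
      block⊆new (there (there (there (here refl)))) = 4F , refl

      S′⊆new : ∀ {v} → v ∈ˢ S′ → v ∈ˢ S ⊎ ∃[ q ] Vec.lookup new q ≡ v
      S′⊆new {v} v∈ with S′⊆ v∈
      ... | inj₁ v∈S          = inj₁ v∈S
      ... | inj₂ (inj₁ refl)  = inj₂ (2F , refl)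
      ... | inj₂ (inj₂ v∈blk) = inj₂ (block⊆new (subst (v ∈_) block≡ v∈blk))

      realised′ : Realised T (_∈ˢ S′)
      realised′ = realised-attach r a₀ new new-unique new-∉ new-adj cross-adj S⊆S′ new-∈ S′⊆new

    -- Both summands must attain their bounds: the block has exactly four entries, which fixes its
    -- shape, and the previous state was tight already.
    tight′ : length (block ++ ls) ≡ 2 + length (z ∷ zs) * 4 → Unique (block ++ ls) → Realised T (_∈ˢ S′)
    tight′ eq unique =
      let block≡4 , ls-tight = +-split-≡ length-block≤4 length≤ (trans (sym (length-++ block)) eq)
          block-unique , ls-unique = unique-++⁻ block unique
          y , j , x , k , fresh≡ , mate-y , mate-j = withMates-four nbrsIn fresh fresh-mates≤1 length-fresh≤2 block≡4
          block≡ = trans (cong (withMates nbrsIn) fresh≡) (cong₂ (λ as bs → y ∷ as ++ j ∷ bs ++ []) mate-y mate-j)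
      in Tight.realised′ (tight ls-tight ls-unique) fresh≡ mate-y mate-j (subst Unique block≡ block-unique)

    step : State
    step = record
      { ls = block ++ ls
      ; zs = z ∷ zs
      ; zs-unique = ¬Any⇒All¬ zs (z∉S ∘ inj₂) ∷ zs-unique
      ; zs-∉F = λ { (here refl) → z∉F ; (there v∈) → zs-∉F v∈ }
      ; closed = closed′
      ; length≤ = ≤-trans (≤-reflexive (length-++ block)) (+-mono-≤ length-block≤4 length≤)
      ; tight = tight′
      ; root = let v , v∈S = root in v , S⊆S′ v∈S }

  -- A vertex of F with its partner, if there is one, is a component of T[F]. It has two vertices
  -- exactly when it is a K₂.
  initial : ∀ {v} → v ∈ₛ F → State
  initial {v} v∈F = record
    { ls = v ∷ nbrsIn v
    ; zs = []
    ; zs-unique = []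
    ; zs-∉F = λ ()
    ; closed = closed₀
    ; length≤ = s≤s (length-nbrsIn≤1 v∈F)
    ; tight = λ eq _ → tight₀ eq
    ; root = v , inj₁ (here refl) }
    where
    closed₀ : Closed (v ∷ nbrsIn v , [])
    closed₀ (inj₁ (here refl)) vw w∈F = inj₁ (there (∈-nbrsIn⁺ vw w∈F))
    closed₀ (inj₁ (there t∈)) tw w∈F =
      let vt , t∈F = ∈-nbrsIn⁻ t∈ in inj₁ (here (mate-unique t∈F w∈F v∈F tw (Adj-sym T vt)))

    tight₀ : length (v ∷ nbrsIn v) ≡ 2 → Realised T (_∈ˢ (v ∷ nbrsIn v , []))
    -- The membership facts are abstracted together with the list, so that the adjacency of `v` and
    -- `w` survives the match.
    tight₀ eq with nbrsIn v | ∈-nbrsIn⁻ {v}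
    tight₀ eq | w ∷ [] | mate = realised-K₂ (proj₁ (mate (here refl))) (inj₁ (here refl)) (inj₁ (there (here refl))) λ where
      (inj₁ (here e))         → inj₁ e
      (inj₁ (there (here e))) → inj₂ e

  -- A walk from a vertex of S to a vertex outside would have to use an edge leaving S.
  exhausted : ∀ S → (∃[ v ] v ∈ˢ S) → ¬ (∃[ u ] ∃[ z ] (u ∈ˢ S × ¬ z ∈ˢ S × Adj u z)) → ∀ v → v ∈ˢ S
  exhausted S (r , r∈S) no-exit v = walk r∈S (connected r v)
    where
    walk : ∀ {a b} → a ∈ˢ S → Star Adj a b → b ∈ˢ S
    walk a∈ ε = a∈
    walk {a} a∈ (_◅_ {j = c} ac cb) with c ∈ˢ? S
    ... | yes c∈ = walk c∈ cb
    ... | no  c∉ = contradiction (a , c , a∈ , c∉ , ac) no-exit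

  -- zs is unique, hence of length at most n, so the fuel never runs out.
  grow : ∀ fuel (st : State) → n < fuel + length (State.zs st) → ∃[ st′ ] (∀ v → v ∈ˢ State.S st′)
  grow zero st n< = contradiction (≤-trans n< (unique⇒length≤n (State.zs-unique st))) (<-irrefl refl)
  grow (suc fuel) st n< with any? (λ u → any? (λ z → (u ∈ˢ? State.S st) ×-dec ¬? (z ∈ˢ? State.S st) ×-dec Adj? T u z))
  ... | yes (u , z , u∈S , z∉S , uz) = grow fuel (Step.step st u∈S z∉S uz) (subst (n <_) (sym (+-suc fuel _)) n<)
  ... | no  no-exit                  = st , exhausted (State.S st) (State.root st) no-exit

  -- The bound and its equality case for one dissociation set

  module Final (st : State) (everything : ∀ v → v ∈ˢ State.S st) where
    open State st

    F⊆ls : ∀ {v} → v ∈ₛ F → v ∈ ls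
    F⊆ls {v} v∈F = [ id , (λ v∈zs → contradiction v∈F (zs-∉F v∈zs)) ]′ (everything v)

    ∣F∣≤length-ls : ∣ F ∣ ℕ.≤ length ls
    ∣F∣≤length-ls = ⊆⇒∣p∣≤length ls F⊆ls

    length-zs+∣F∣≤n : length zs + ∣ F ∣ ℕ.≤ n
    length-zs+∣F∣≤n = begin
      length zs + ∣ F ∣ ≤⟨ +-monoˡ-≤ ∣ F ∣ (unique⇒length≤∣p∣ zs-unique (x∉p⇒x∈∁p ∘ zs-∉F)) ⟩
      ∣ ∁ F ∣ + ∣ F ∣   ≡⟨ cong (_+ ∣ F ∣) (∣∁p∣≡n∸∣p∣ F) ⟩
      n ℕ.∸ ∣ F ∣ + ∣ F ∣ ≡⟨ m∸n+n≡m (∣p∣≤n F) ⟩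
      n                 ∎
      where open ≤-Reasoning

    -- Serves twice: chained with the bound on `∣ F ∣` it gives `bound`, and under equality, after
    -- cancelling `∣ F ∣ * 4`, it gives the reverse estimate `F-large`.
    slack : 2 + length zs * 4 + ∣ F ∣ * 4 ℕ.≤ 4 * n + 2
    slack = begin
      2 + length zs * 4 + ∣ F ∣ * 4 ≡⟨ regroup (length zs) ∣ F ∣ ⟩
      4 * (length zs + ∣ F ∣) + 2   ≤⟨ +-monoˡ-≤ 2 (*-monoʳ-≤ 4 length-zs+∣F∣≤n) ⟩
      4 * n + 2                     ∎
      where
      open ≤-Reasoning
      regroup : ∀ r f → 2 + r * 4 + f * 4 ≡ 4 * (r + f) + 2
      regroup = solve-∀

    5∣F∣ : ∣ F ∣ * 5 ≡ ∣ F ∣ + ∣ F ∣ * 4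
    5∣F∣ = lemma ∣ F ∣
      where
      lemma : ∀ f → f * 5 ≡ f + f * 4
      lemma = solve-∀

    bound : ∣ F ∣ * 5 ℕ.≤ 4 * n + 2
    bound = begin
      ∣ F ∣ * 5                     ≡⟨ 5∣F∣ ⟩
      ∣ F ∣ + ∣ F ∣ * 4             ≤⟨ +-monoˡ-≤ (∣ F ∣ * 4) (≤-trans ∣F∣≤length-ls length≤) ⟩
      2 + length zs * 4 + ∣ F ∣ * 4 ≤⟨ slack ⟩
      4 * n + 2                     ∎
      where open ≤-Reasoning

    -- Equality squeezes `∣ F ∣`, `length ls` and `2 + length zs * 4` together, so `ls` is free of
    -- repetitions and the `tight` field applies to the whole vertex set.
    equality⇒arises : ∣ F ∣ * 5 ≡ 4 * n + 2 → ArisesFromK₂ T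
    equality⇒arises eq = realised-⊤⇒arises
      (tight (≤-antisym length≤ (≤-trans F-large ∣F∣≤length-ls)) (tight⇒unique ls F⊆ls (≤-trans length≤ F-large)))
      everything
      where
      F-large : 2 + length zs * 4 ℕ.≤ ∣ F ∣
      F-large = +-cancelʳ-≤ (∣ F ∣ * 4) _ _ (≤-trans slack (≤-reflexive (trans (sym eq) 5∣F∣)))

  dissociation-bound : ∣ F ∣ * 5 ℕ.≤ 4 * n + 2 × (∣ F ∣ * 5 ≡ 4 * n + 2 → ArisesFromK₂ T)
  dissociation-bound with nonempty? F
  -- Initially `zs` is empty, so fuel `suc n` is what the strict inequality asks for.
  ... | yes (v , v∈F) = let st , everything = grow (suc n) (initial v∈F) (s≤s (m≤m+n n _))
                            open Final st everything
                        in bound , equality⇒arises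
  -- With F empty there is no starting component; the bound is trivial and equality would read 0 =
  -- 4n + 2.
  ... | no F≡∅ rewrite Empty-unique F≡∅ | ∣⊥∣≡0 n = z≤n , λ eq → contradiction (trans eq (+-comm (4 * n) 2)) λ ()

-- Dissociation sets of graphs arising from K₂

-- A dissociation set attaining the bound, as a list without repetitions. Induced degree at most 1
-- is phrased as uniqueness of the neighbour, which transfers along injections without counting.
record TightDissociation {n} (G : Graph n) : Set where
  open Graph G
  field
    members   : List (Fin n)
    unique    : Unique members
    dissoc    : ∀ {v w w′} → v ∈ members → w ∈ members → w′ ∈ members → Adj v w → Adj v w′ → w ≡ w′
    length≡   : length members * 5 ≡ 4 * n + 2

tight-K₂ : TightDissociation K₂
tight-K₂ = record
  { members = 0F ∷ 1F ∷ []
  ; unique = ((λ ()) ∷ []) ∷ [] ∷ []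
  ; dissoc = λ {v} {w} {w′} _ _ _ → only v w w′
  ; length≡ = refl }
  where
  open Graph K₂
  only : ∀ v w w′ → Adj v w → Adj v w′ → w ≡ w′
  only 0F 1F 1F _ _ = refl
  only 1F 0F 0F _ _ = refl
  only 1F 1F _ () _
  only 1F 0F 1F _ ()

-- Only z is joined to the old graph, and z is left out; the rest of the path splits into the edges
-- xy and jk. Four more members and five more vertices add 20 to each side of `length≡`.
tight-attach : ∀ {n} {G : Graph n} → TightDissociation G → ∀ u → TightDissociation (attachP₅ G u)
tight-attach {n} {G} td u = record
  { members = old ++ new
  ; unique = ++⁺ (map⁺ (↑ˡ-injective 5 _ _) unique) (map⁺ (↑ʳ-injective n _ _) xyjk-unique) disjoint
  ; dissoc = λ {v} {w} {w′} v∈ w∈ w′∈ vw vw′ →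
      splitAt-injective w w′ (inner (splitAt n v) (splitAt n w) (splitAt n w′) (∈⇒Member v∈) (∈⇒Member w∈) (∈⇒Member w′∈) vw vw′)
  ; length≡ = length≡′ }
  where
  open TightDissociation td

  xyjk : List (Fin 5)
  xyjk = 0F ∷ 1F ∷ 3F ∷ 4F ∷ []

  old new : List (Fin (n + 5))
  old = map (_↑ˡ 5) members
  new = map (n ↑ʳ_) xyjk

  xyjk-unique : Unique xyjk
  xyjk-unique = ((λ ()) ∷ (λ ()) ∷ (λ ()) ∷ []) ∷ ((λ ()) ∷ (λ ()) ∷ []) ∷ ((λ ()) ∷ []) ∷ [] ∷ []

  Member : Fin n ⊎ Fin 5 → Set
  Member = [ _∈ members , _≢ 2F ]′

  disjoint : ∀ {v} → ¬ (v ∈ old × v ∈ new)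
  disjoint (v∈old , v∈new) with ∈-map⁻ (_↑ˡ 5) v∈old | ∈-map⁻ (n ↑ʳ_) v∈new
  ... | a , _ , refl | q , _ , e
    with () ← trans (sym (splitAt-↑ˡ n a 5)) (trans (cong (splitAt n) e) (splitAt-↑ʳ n 5 q))

  xyjk-≢ : ∀ {q} → q ∈ xyjk → q ≢ 2F
  xyjk-≢ q∈ refl with q∈
  ... | there (there (there (there ())))

  ∈⇒Member : ∀ {v} → v ∈ old ++ new → Member (splitAt n v)
  ∈⇒Member v∈ with ∈-++⁻ old v∈
  ... | inj₁ v∈old with a , a∈ , refl ← ∈-map⁻ (_↑ˡ 5) v∈old rewrite splitAt-↑ˡ n a 5 = a∈
  ... | inj₂ v∈new with q , q∈ , refl ← ∈-map⁻ (n ↑ʳ_) v∈new rewrite splitAt-↑ʳ n 5 q = xyjk-≢ q∈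

  cross : ∀ a q → q ≢ 2F → attachAdj G u (inj₁ a) (inj₂ q) ≡ false
  cross a 0F _  = refl
  cross a 1F _  = refl
  cross a 2F q≢ = contradiction refl q≢
  cross a 3F _  = refl
  cross a 4F _  = refl

  true≢ : ∀ {b} {A : Set} → b ≡ false → b ≡ true → A
  true≢ refl ()

  mate : Fin 5 → Fin 5
  mate 0F = 1F
  mate 1F = 0F
  -- A dummy value: `2F` is z, which `new-mate` excludes.
  mate 2F = 2F
  mate 3F = 4F
  mate 4F = 3F

  new-mate : ∀ p q → p ≢ 2F → q ≢ 2F → attachAdj G u (inj₂ p) (inj₂ q) ≡ true → q ≡ mate p
  new-mate 2F _  p≢ _ _ = contradiction refl p≢
  new-mate _  2F _ q≢ _ = contradiction refl q≢
  new-mate 0F 1F _ _ _ = refl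
  new-mate 1F 0F _ _ _ = refl
  new-mate 3F 4F _ _ _ = refl
  new-mate 4F 3F _ _ _ = refl
  new-mate 0F 3F _ _ ()
  new-mate 0F 4F _ _ ()
  new-mate 1F 3F _ _ ()
  new-mate 1F 4F _ _ ()
  new-mate 3F 0F _ _ ()
  new-mate 4F 0F _ _ ()
  new-mate 3F 1F _ _ ()
  new-mate 4F 1F _ _ ()

  inner : ∀ s t t′ → Member s → Member t → Member t′ → attachAdj G u s t ≡ true → attachAdj G u s t′ ≡ true → t ≡ t′
  inner (inj₁ a) (inj₁ b) (inj₁ c) a∈ b∈ c∈ ab ac = cong inj₁ (dissoc a∈ b∈ c∈ ab ac)
  inner (inj₁ a) (inj₂ q) _ _ q≢ _ aq _ = true≢ (cross a q q≢) aq
  inner (inj₁ a) (inj₁ _) (inj₂ q) _ _ q≢ _ aq = true≢ (cross a q q≢) aq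
  inner (inj₂ p) (inj₁ b) _ p≢ _ _ pb _ = true≢ (cross b p p≢) (trans (attachAdj-sym G u (inj₁ b) (inj₂ p)) pb)
  inner (inj₂ p) (inj₂ _) (inj₁ b) p≢ _ _ _ pb = true≢ (cross b p p≢) (trans (attachAdj-sym G u (inj₁ b) (inj₂ p)) pb)
  inner (inj₂ p) (inj₂ q) (inj₂ q′) p≢ q≢ q′≢ pq pq′ =
    cong inj₂ (trans (new-mate p q p≢ q≢ pq) (sym (new-mate p q′ p≢ q′≢ pq′)))

  length≡′ : length (old ++ new) * 5 ≡ 4 * (n + 5) + 2
  length≡′ = begin
    length (old ++ new) * 5    ≡⟨ cong (_* 5) (trans (length-++ old) (cong (_+ 4) (length-map (_↑ˡ 5) members))) ⟩
    (length members + 4) * 5   ≡⟨ expand (length members) ⟩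
    length members * 5 + 20    ≡⟨ cong (_+ 20) length≡ ⟩
    4 * n + 2 + 20             ≡⟨ collect n ⟩
    4 * (n + 5) + 2            ∎
    where
    open ≡-Reasoning
    expand : ∀ m → (m + 4) * 5 ≡ m * 5 + 20
    expand = solve-∀
    collect : ∀ n → 4 * n + 2 + 20 ≡ 4 * (n + 5) + 2
    collect = solve-∀

tight-≅ : ∀ {m n} {G : Graph m} {H : Graph n} → G ≅ H → TightDissociation G → TightDissociation H
tight-≅ {m} {n} {G} {H} iso td = record
  { members = map to members
  ; unique = map⁺ (Injection.injective (Inverse⇒Injection bijection)) unique
  ; dissoc = dissoc′
  ; length≡ = trans (cong (_* 5) (length-map to members)) (subst (λ k → length members * 5 ≡ 4 * k + 2) (↔⇒≡ bijection) length≡) }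
  where
  open TightDissociation td
  open _≅_ iso
  open Inverse bijection using (to)
  dissoc′ : ∀ {v w w′} → v ∈ map to members → w ∈ map to members → w′ ∈ map to members →
            Graph.Adj H v w → Graph.Adj H v w′ → w ≡ w′
  dissoc′ v∈ w∈ w′∈ vw vw′
    with a , a∈ , refl ← ∈-map⁻ to v∈ | b , b∈ , refl ← ∈-map⁻ to w∈ | c , c∈ , refl ← ∈-map⁻ to w′∈ =
    cong to (dissoc a∈ b∈ c∈ (trans (sym (preserves a b)) vw) (trans (sym (preserves a c)) vw′))

arises⇒tight : ∀ {n} {G : Graph n} → ArisesFromK₂ G → TightDissociation G
arises⇒tight base             = tight-K₂
arises⇒tight (attach ar u)    = tight-attach (arises⇒tight ar) u
arises⇒tight (resp-≅ iso ar)  = tight-≅ iso (arises⇒tight ar)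

-- As a subset, `members` is a dissociation set, hence no larger than a maximum one.
tight⇒≤ψ : ∀ {n} {G : Graph n} → TightDissociation G → 4 * n + 2 ℕ.≤ ψ G * 5
tight⇒≤ψ {n} {G} td = begin
  4 * n + 2          ≡⟨ length≡ ⟨
  length members * 5 ≤⟨ *-monoˡ-≤ 5 (unique⇒length≤∣p∣ unique ∈-fromList⁺) ⟩
  ∣ F ∣ * 5          ≤⟨ *-monoˡ-≤ 5 (∣F∣≤ψ G F-dissoc) ⟩
  ψ G * 5            ∎
  where
  open ≤-Reasoning
  open TightDissociation td
  F : Subset n
  F = fromList members
  F-dissoc : Graph.IsDissociationSet G F
  F-dissoc v v∈F = ≡⇒∣p∣≤1 λ w∈ w′∈ →
    let w∈N , w∈F = x∈p∩q⁻ (Graph.neighbourhood G v) F w∈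
        w′∈N , w′∈F = x∈p∩q⁻ (Graph.neighbourhood G v) F w′∈
    in dissoc (∈-fromList⁻ members v∈F) (∈-fromList⁻ members w∈F) (∈-fromList⁻ members w′∈F)
              (∈-neighbourhood⁻ G w∈N) (∈-neighbourhood⁻ G w′∈N)

-- From natural numbers to rational fractions

open import Data.Integer using (+_)

module _ (a b : ℕ) where

  private
    -- Since `_/_` reduces to lowest terms, cross-multiplication is done on unnormalised fractions.
    -- `mkℚᵘ` takes the denominator minus one, so 0 and 4 stand for 1 and 5.
    p q : ℚᵘ
    p = mkℚᵘ (+ a) 0
    q = mkℚᵘ (+ b) 4

  *5≤⇒/≤/5 : a * 5 ℕ.≤ b → (+ a) / 1 ≤ (+ b) / 5
  *5≤⇒/≤/5 le = toℚᵘ-cancel-≤ (ℚᵘ.≤-respˡ-≃ (ℚᵘ.≃-sym (toℚᵘ-fromℚᵘ p)) (ℚᵘ.≤-respʳ-≃ (ℚᵘ.≃-sym (toℚᵘ-fromℚᵘ q))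
    (*≤* (subst₂ ℤ._≤_ (ℤ.pos-* a 5) (sym (ℤ.*-identityʳ (+ b))) (ℤ.+≤+ le)))))

  *5≡⇔/≡/5 : (a * 5 ≡ b) ⇔ ((+ a) / 1 ≡ (+ b) / 5)
  *5≡⇔/≡/5 = mk⇔
    (λ eq → fromℚᵘ-cong {p} {q} (*≡* (trans (sym (ℤ.pos-* a 5)) (trans (cong +_ eq) (sym (ℤ.*-identityʳ (+ b)))))))
    (λ eq → case fromℚᵘ-injective {p} {q} eq of λ
      { (*≡* e) → ℤ.+-injective (trans (ℤ.pos-* a 5) (trans e (ℤ.*-identityʳ (+ b)))) })

theorem2p3 : ∀ (n : ℕ) (T : Graph n) → Graph.IsTree T → Graph.Subcubic T →
    ((+ ψ T) / 1 ≤ (+ (4 * n + 2)) / 5) ×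
    (((+ ψ T) / 1 ≡ (+ (4 * n + 2)) / 5) ⇔ ArisesFromK₂ T)
theorem2p3 n T ((_ , connected) , _) subcubic =
  *5≤⇒/≤/5 (ψ T) (4 * n + 2) bound ,
  mk⇔ (equality⇒arises ∘ Equivalence.from 5ψ≡⇔)
      (λ arises → Equivalence.to 5ψ≡⇔ (≤-antisym bound (tight⇒≤ψ (arises⇒tight arises))))
  where
  open Growth T subcubic connected (maximumDissociationSet T) (maximumDissociationSet-isDissociationSet T)
  bound = proj₁ dissociation-bound
  equality⇒arises = proj₂ dissociation-bound
  5ψ≡⇔ = *5≡⇔/≡/5 (ψ T) (4 * n + 2)
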